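{- Let $M\in\mathbb{R}^{m\times m}$ and $q\in\mathbb{R}^m$, and let $$C(q,M)=\begin{bmatrix} M & q+e\\ 0 & 1\end{bmatrix}\in\mathbb{R}^{(m+1)\times(m+1)}.$$ (i) Given $\bar x=\begin{bmatrix}\bar y\\ \bar t\end{bmatrix}\in\mathrm{SNE}_+(C(q,M))$, let $\bar z=\bar y\,\frac1{\bar t}$. Then $\bar z\in\mathrm{SOL}(q,M)$. (ii) Given $\bar z\in\mathrm{SOL}(q,M)$, let $\bar t=\frac{1}{e^{T}\bar z+1}$ and $\bar y=\bar z\,\bar t$. Then $\bar x=\begin{bmatrix}\bar y\\ \bar t\end{bmatrix}\in\mathrm{SNE}_+(C(q,M))$.
   Context: $e$ denotes the all-ones vector of appropriate dimension; vector inequalities are entrywise. $\mathrm{SOL}(q,M)$ is the set of all $z\in\mathbb{R}^m$ with $q+Mz\ge 0$, $z\ge 0$, $z^{T}(q+Mz)=0$. For $C\in\mathbb{R}^{n\times n}$ (the cost matrix of a symmetric bimatrix game), $\mathrm{SNE}(C)$ is the set of symmetric Nash equilibria, i.e. of all $x\in\mathbb{R}^n$ with $Cx\ge e(x^{T}Cx)$, $x\ge 0$, $e^{T}x=1$. Elements of $\mathrm{SNE}(C(q,M))$ are written $\begin{bmatrix} y\\ t\end{bmatrix}$ with $y\in\mathbb{R}^m$, $t\in\mathbb{R}$, and $\mathrm{SNE}_+(C(q,M))$ is the set of those with $t>0$. -}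

module Defs where

open import Algebra.Bundles using (CommutativeRing)
import Algebra.Properties.Semiring.Sum as SemiringSum
open import Data.Fin using (Fin; zero; suc)
open import Data.Nat as ℕ using (ℕ; zero; suc)
import Data.Nat.Properties as ℕ
open import Data.Product using (∃; _×_; _,_; proj₁; proj₂)
open import Data.Rational as ℚ using (ℚ; 0ℚ; 1ℚ; ½; ∣_∣)
import Data.Rational.Properties as ℚ
open import Data.Rational.Solver using (module +-*-Solver)
open import Data.Vec.Functional using (Vector; []; _∷_; _++_; map; replicate; zipWith)
open import Data.Vec.Functional.Relation.Binary.Pointwise using (Pointwise)
open import Level using (0ℓ)
open import Relation.Binary.PropositionalEquality
open import Relation.Nullary using (yes; no; contradiction)
open import Relation.Unary using (Pred; _∈_)

infix  8 -_
infixl 7 _*_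
infixl 6 _+_
infix  4 _≈_ _≤_ _<_ _≥_

private
  open +-*-Solver using (solve; con; _:=_; _:+_; _:*_; :-_; _:-_)

  abstract
    *-monoˡ : ∀ {p q} r → 0ℚ ℚ.≤ r → p ℚ.≤ q → r ℚ.* p ℚ.≤ r ℚ.* q
    *-monoˡ r 0≤r = ℚ.*-monoˡ-≤-nonNeg r {{ℚ.nonNegative 0≤r}}

    *-monoʳ : ∀ {p q} r → 0ℚ ℚ.≤ r → p ℚ.≤ q → p ℚ.* r ℚ.≤ q ℚ.* r
    *-monoʳ r 0≤r = ℚ.*-monoʳ-≤-nonNeg r {{ℚ.nonNegative 0≤r}}

    0<1 : 0ℚ ℚ.< 1ℚ
    0<1 = ℚ.positive⁻¹ 1ℚ

    <⇒≤ : ∀ {p q} → p ℚ.< q → p ℚ.≤ q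
    <⇒≤ = ℚ.<⇒≤

    weaken : ∀ {p q r} → q ≡ r → p ℚ.≤ q → p ℚ.≤ r
    weaken refl p≤q = p≤q

    0<½ : 0ℚ ℚ.< ½
    0<½ = ℚ.positive⁻¹ ½

    0<+ : ∀ {p q} → 0ℚ ℚ.≤ p → 0ℚ ℚ.< q → 0ℚ ℚ.< p ℚ.+ q
    0<+ {p} {q} 0≤p 0<q = subst (ℚ._< p ℚ.+ q) (ℚ.+-identityˡ 0ℚ) (ℚ.+-mono-≤-< 0≤p 0<q)

    0<* : ∀ {p q} → 0ℚ ℚ.< p → 0ℚ ℚ.< q → 0ℚ ℚ.< p ℚ.* q
    0<* {p} {q} 0<p 0<q =
      subst (ℚ._< p ℚ.* q) (ℚ.*-zeroʳ p) (ℚ.*-monoʳ-<-pos p {{ℚ.positive 0<p}} 0<q)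

    divide : ∀ k ε → 0ℚ ℚ.< k → 0ℚ ℚ.< ε → ∃ λ δ → 0ℚ ℚ.< δ × k ℚ.* δ ≡ ε
    divide k ε 0<k 0<ε = k⁻¹ ℚ.* ε , 0<* 0<k⁻¹ 0<ε , (begin
      k ℚ.* (k⁻¹ ℚ.* ε) ≡⟨ ℚ.*-assoc k k⁻¹ ε ⟨
      k ℚ.* k⁻¹ ℚ.* ε   ≡⟨ cong (ℚ._* ε) (ℚ.*-inverseʳ k) ⟩
      1ℚ ℚ.* ε          ≡⟨ ℚ.*-identityˡ ε ⟩
      ε                 ∎)
      where
      open ≡-Reasoning
      instance
        k>0 : ℚ.Positive k
        k>0 = ℚ.positive 0<k
        k≢0 : ℚ.NonZero k
        k≢0 = ℚ.pos⇒nonZero k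
      k⁻¹ : ℚ
      k⁻¹ = ℚ.1/ k
      0<k⁻¹ : 0ℚ ℚ.< k⁻¹
      0<k⁻¹ = ℚ.positive⁻¹ k⁻¹ {{ℚ.1/pos⇒pos k}}

    halve : ∀ ε → 0ℚ ℚ.< ε → ∃ λ δ → 0ℚ ℚ.< δ × δ ℚ.+ δ ≡ ε
    halve ε 0<ε = ½ ℚ.* ε , 0<* (ℚ.positive⁻¹ ½) 0<ε ,
      solve 1 (λ e → con ½ :* e :+ con ½ :* e := e) refl ε

    dist-refl : ∀ p → ∣ p ℚ.- p ∣ ≡ 0ℚ
    dist-refl p = cong ∣_∣ (ℚ.+-inverseʳ p)

    dist-sym : ∀ p q → ∣ p ℚ.- q ∣ ≡ ∣ q ℚ.- p ∣
    dist-sym p q = trans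
      (cong ∣_∣ (solve 2 (λ a b → a :- b := :- (b :- a)) refl p q))
      (ℚ.∣-p∣≡∣p∣ (q ℚ.- p))

    dist-trans : ∀ p q r {δ ε} → ∣ p ℚ.- q ∣ ℚ.≤ δ → ∣ q ℚ.- r ∣ ℚ.≤ ε →
                 ∣ p ℚ.- r ∣ ℚ.≤ δ ℚ.+ ε
    dist-trans p q r {δ} {ε} pq qr = begin
      ∣ p ℚ.- r ∣
        ≡⟨ cong ∣_∣ (solve 3 (λ a b c → a :- c := (a :- b) :+ (b :- c)) refl p q r) ⟩
      ∣ (p ℚ.- q) ℚ.+ (q ℚ.- r) ∣     ≤⟨ ℚ.∣p+q∣≤∣p∣+∣q∣ (p ℚ.- q) (q ℚ.- r) ⟩
      ∣ p ℚ.- q ∣ ℚ.+ ∣ q ℚ.- r ∣     ≤⟨ ℚ.+-mono-≤ pq qr ⟩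
      δ ℚ.+ ε                         ∎
      where open ℚ.≤-Reasoning

    dist-+ : ∀ p q p′ q′ {δ ε} → ∣ p ℚ.- p′ ∣ ℚ.≤ δ → ∣ q ℚ.- q′ ∣ ℚ.≤ ε →
             ∣ (p ℚ.+ q) ℚ.- (p′ ℚ.+ q′) ∣ ℚ.≤ δ ℚ.+ ε
    dist-+ p q p′ q′ {δ} {ε} pp qq = begin
      ∣ (p ℚ.+ q) ℚ.- (p′ ℚ.+ q′) ∣
        ≡⟨ cong ∣_∣ (solve 4 (λ a b c d → (a :+ b) :- (c :+ d) := (a :- c) :+ (b :- d))
                       refl p q p′ q′) ⟩
      ∣ (p ℚ.- p′) ℚ.+ (q ℚ.- q′) ∣   ≤⟨ ℚ.∣p+q∣≤∣p∣+∣q∣ (p ℚ.- p′) (q ℚ.- q′) ⟩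
      ∣ p ℚ.- p′ ∣ ℚ.+ ∣ q ℚ.- q′ ∣   ≤⟨ ℚ.+-mono-≤ pp qq ⟩
      δ ℚ.+ ε                         ∎
      where open ℚ.≤-Reasoning

    dist-neg : ∀ p q → ∣ (ℚ.- p) ℚ.- (ℚ.- q) ∣ ≡ ∣ p ℚ.- q ∣
    dist-neg p q = trans
      (cong ∣_∣ (solve 2 (λ a b → (:- a) :- (:- b) := :- (a :- b)) refl p q))
      (ℚ.∣-p∣≡∣p∣ (p ℚ.- q))

    dist-* : ∀ p q p′ q′ {A B δ} → ∣ p ∣ ℚ.≤ A → ∣ q′ ∣ ℚ.≤ B → 0ℚ ℚ.≤ δ →
             ∣ p ℚ.- p′ ∣ ℚ.≤ δ → ∣ q ℚ.- q′ ∣ ℚ.≤ δ →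
             ∣ (p ℚ.* q) ℚ.- (p′ ℚ.* q′) ∣ ℚ.≤ (A ℚ.+ B) ℚ.* δ
    dist-* p q p′ q′ {A} {B} {δ} p≤A q′≤B 0≤δ pp qq = begin
      ∣ (p ℚ.* q) ℚ.- (p′ ℚ.* q′) ∣
        ≡⟨ cong ∣_∣ (solve 4 (λ a b c d → (a :* b) :- (c :* d)
                         := a :* (b :- d) :+ d :* (a :- c)) refl p q p′ q′) ⟩
      ∣ p ℚ.* (q ℚ.- q′) ℚ.+ q′ ℚ.* (p ℚ.- p′) ∣
        ≤⟨ ℚ.∣p+q∣≤∣p∣+∣q∣ (p ℚ.* (q ℚ.- q′)) (q′ ℚ.* (p ℚ.- p′)) ⟩
      ∣ p ℚ.* (q ℚ.- q′) ∣ ℚ.+ ∣ q′ ℚ.* (p ℚ.- p′) ∣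
        ≡⟨ cong₂ ℚ._+_ (ℚ.∣p*q∣≡∣p∣*∣q∣ p (q ℚ.- q′)) (ℚ.∣p*q∣≡∣p∣*∣q∣ q′ (p ℚ.- p′)) ⟩
      ∣ p ∣ ℚ.* ∣ q ℚ.- q′ ∣ ℚ.+ ∣ q′ ∣ ℚ.* ∣ p ℚ.- p′ ∣
        ≤⟨ ℚ.+-mono-≤ (*-monoˡ ∣ p ∣ (ℚ.0≤∣p∣ p) qq) (*-monoˡ ∣ q′ ∣ (ℚ.0≤∣p∣ q′) pp) ⟩
      ∣ p ∣ ℚ.* δ ℚ.+ ∣ q′ ∣ ℚ.* δ
        ≤⟨ ℚ.+-mono-≤ (*-monoʳ δ 0≤δ p≤A) (*-monoʳ δ 0≤δ q′≤B) ⟩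
      A ℚ.* δ ℚ.+ B ℚ.* δ
        ≡⟨ ℚ.*-distribʳ-+ δ A B ⟨
      (A ℚ.+ B) ℚ.* δ ∎
      where open ℚ.≤-Reasoning

-- The reals are the Cauchy sequences of rationals up to _≈_.  Order and
-- equality are those of constructive analysis: x < y carries a positive
-- rational gap, and x ≤ y is equivalent to ¬ (y < x).
Eventually : Pred ℕ 0ℓ → Set
Eventually P = ∃ λ N → ∀ n → N ℕ.≤ n → P n

Cauchy : (ℕ → ℚ) → Set
Cauchy s = ∀ ε → 0ℚ ℚ.< ε →
  ∃ λ N → ∀ m n → N ℕ.≤ m → N ℕ.≤ n → ∣ s m ℚ.- s n ∣ ℚ.≤ ε

-- Without eta and with operations defined by copatterns, x + y is a
-- neutral term from which x and y can be inferred.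
record ℝ : Set where
  no-eta-equality
  field
    seq    : ℕ → ℚ
    cauchy : Cauchy seq

open ℝ public

record _≈_ (x y : ℝ) : Set where
  constructor mk≈
  field
    close : ∀ ε → 0ℚ ℚ.< ε → Eventually λ n → ∣ seq x n ℚ.- seq y n ∣ ℚ.≤ ε

record _≤_ (x y : ℝ) : Set where
  constructor mk≤
  field
    below : ∀ ε → 0ℚ ℚ.< ε → Eventually λ n → seq x n ℚ.≤ seq y n ℚ.+ ε

record _<_ (x y : ℝ) : Set where
  constructor mk<
  field
    gap          : ℚ
    gap-positive : 0ℚ ℚ.< gap
    separated    : Eventually λ n → seq x n ℚ.+ gap ℚ.≤ seq y n

_≥_ : ℝ → ℝ → Set
x ≥ y = y ≤ x

private
  abstract
    both : ∀ {P Q R : Pred ℕ 0ℓ} → (∀ n → P n → Q n → R n) →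
           Eventually P → Eventually Q → Eventually R
    both f (N , p) (N′ , q) = N ℕ.⊔ N′ , λ n N≤n →
      f n (p n (ℕ.m⊔n≤o⇒m≤o N N′ N≤n)) (q n (ℕ.m⊔n≤o⇒n≤o N N′ N≤n))

    bounded : ∀ s → Cauchy s → ∃ λ B → 0ℚ ℚ.< B × Eventually λ n → ∣ s n ∣ ℚ.≤ B
    bounded s c =
      let N , close = c 1ℚ 0<1 in
      let open ℚ.≤-Reasoning in
      ∣ s N ∣ ℚ.+ 1ℚ , 0<+ (ℚ.0≤∣p∣ (s N)) 0<1 , N , λ n N≤n → begin
      ∣ s n ∣                           ≡⟨ cong ∣_∣ (solve 2 (λ a b → a := b :+ (a :- b)) refl (s n) (s N)) ⟩
      ∣ s N ℚ.+ (s n ℚ.- s N) ∣         ≤⟨ ℚ.∣p+q∣≤∣p∣+∣q∣ (s N) (s n ℚ.- s N) ⟩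
      ∣ s N ∣ ℚ.+ ∣ s n ℚ.- s N ∣       ≤⟨ ℚ.+-monoʳ-≤ ∣ s N ∣ (close n N N≤n ℕ.≤-refl) ⟩
      ∣ s N ∣ ℚ.+ 1ℚ                    ∎

    +-cauchy : ∀ s t → Cauchy s → Cauchy t → Cauchy (λ n → s n ℚ.+ t n)
    +-cauchy s t cs ct ε 0<ε =
      let δ , 0<δ , δ+δ≡ε = halve ε 0<ε
          N , s-close = cs δ 0<δ
          N′ , t-close = ct δ 0<δ
      in N ℕ.⊔ N′ , λ m n m≥ n≥ → weaken δ+δ≡ε (dist-+ (s m) (t m) (s n) (t n)
           (s-close m n (ℕ.m⊔n≤o⇒m≤o N N′ m≥) (ℕ.m⊔n≤o⇒m≤o N N′ n≥))
           (t-close m n (ℕ.m⊔n≤o⇒n≤o N N′ m≥) (ℕ.m⊔n≤o⇒n≤o N N′ n≥)))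

    neg-cauchy : ∀ s → Cauchy s → Cauchy (λ n → ℚ.- s n)
    neg-cauchy s cs ε 0<ε =
      let N , close = cs ε 0<ε
      in N , λ m n m≥ n≥ → ℚ.≤-trans (ℚ.≤-reflexive (dist-neg (s m) (s n))) (close m n m≥ n≥)

    *-cauchy : ∀ s t → Cauchy s → Cauchy t → Cauchy (λ n → s n ℚ.* t n)
    *-cauchy s t cs ct ε 0<ε =
      let A , 0<A , N₁ , s≤A = bounded s cs
          B , 0<B , N₂ , t≤B = bounded t ct
          δ , 0<δ , [A+B]δ≡ε = divide (A ℚ.+ B) ε (0<+ (<⇒≤ 0<A) 0<B) 0<ε
          N₃ , s-close = cs δ 0<δ
          N₄ , t-close = ct δ 0<δ
          N₁₂ = N₁ ℕ.⊔ N₂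
          N₃₄ = N₃ ℕ.⊔ N₄
      in N₁₂ ℕ.⊔ N₃₄ , λ m n m≥ n≥ →
        let m≥₁₂ = ℕ.m⊔n≤o⇒m≤o N₁₂ N₃₄ m≥
            m≥₃₄ = ℕ.m⊔n≤o⇒n≤o N₁₂ N₃₄ m≥
            n≥₁₂ = ℕ.m⊔n≤o⇒m≤o N₁₂ N₃₄ n≥
            n≥₃₄ = ℕ.m⊔n≤o⇒n≤o N₁₂ N₃₄ n≥
        in weaken [A+B]δ≡ε
             (dist-* (s m) (t m) (s n) (t n)
               (s≤A m (ℕ.m⊔n≤o⇒m≤o N₁ N₂ m≥₁₂)) (t≤B n (ℕ.m⊔n≤o⇒n≤o N₁ N₂ n≥₁₂)) (<⇒≤ 0<δ)
               (s-close m n (ℕ.m⊔n≤o⇒m≤o N₃ N₄ m≥₃₄) (ℕ.m⊔n≤o⇒m≤o N₃ N₄ n≥₃₄))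
               (t-close m n (ℕ.m⊔n≤o⇒n≤o N₃ N₄ m≥₃₄) (ℕ.m⊔n≤o⇒n≤o N₃ N₄ n≥₃₄)))

fromℚ : ℚ → ℝ
seq    (fromℚ p) _ = p
cauchy (fromℚ p) ε 0<ε = 0 , λ _ _ _ _ → subst (ℚ._≤ ε) (sym (dist-refl p)) (<⇒≤ 0<ε)

0ℝ 1ℝ : ℝ
0ℝ = fromℚ 0ℚ
1ℝ = fromℚ 1ℚ

_+_ _*_ : ℝ → ℝ → ℝ
seq    (x + y) n = seq x n ℚ.+ seq y n
cauchy (x + y)   = +-cauchy (seq x) (seq y) (cauchy x) (cauchy y)
seq    (x * y) n = seq x n ℚ.* seq y n
cauchy (x * y)   = *-cauchy (seq x) (seq y) (cauchy x) (cauchy y)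

-_ : ℝ → ℝ
seq    (- x) n = ℚ.- seq x n
cauchy (- x)   = neg-cauchy (seq x) (cauchy x)

private
  ≈-pointwise : ∀ {x y} → (∀ n → seq x n ≡ seq y n) → x ≈ y
  ≈-pointwise {x} {y} eq = mk≈ λ ε 0<ε → 0 , λ n _ → ℚ.≤-trans
    (ℚ.≤-reflexive (trans (cong (λ p → ∣ p ℚ.- seq y n ∣) (eq n)) (dist-refl (seq y n))))
    (<⇒≤ 0<ε)

  ≈-refl : ∀ {x} → x ≈ x
  ≈-refl = ≈-pointwise λ _ → refl

  ≈-sym : ∀ {x y} → x ≈ y → y ≈ x
  ≈-sym {x} {y} (mk≈ x≈y) = mk≈ λ ε 0<ε →
    let N , close = x≈y ε 0<ε in
    N , λ n n≥ → ℚ.≤-trans (ℚ.≤-reflexive (dist-sym (seq y n) (seq x n))) (close n n≥)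

  ≈-trans : ∀ {x y z} → x ≈ y → y ≈ z → x ≈ z
  ≈-trans {x} {y} {z} (mk≈ x≈y) (mk≈ y≈z) = mk≈ λ ε 0<ε →
    let δ , 0<δ , δ+δ≡ε = halve ε 0<ε in
    both (λ n p q → weaken δ+δ≡ε (dist-trans (seq x n) (seq y n) (seq z n) p q))
      (x≈y δ 0<δ) (y≈z δ 0<δ)

  +-cong : ∀ {x x′ y y′} → x ≈ x′ → y ≈ y′ → x + y ≈ x′ + y′
  +-cong {x} {x′} {y} {y′} (mk≈ x≈x′) (mk≈ y≈y′) = mk≈ λ ε 0<ε →
    let δ , 0<δ , δ+δ≡ε = halve ε 0<ε in
    both (λ n p q → weaken δ+δ≡ε (dist-+ (seq x n) (seq y n) (seq x′ n) (seq y′ n) p q))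
      (x≈x′ δ 0<δ) (y≈y′ δ 0<δ)

  neg-cong : ∀ {x y} → x ≈ y → - x ≈ - y
  neg-cong {x} {y} (mk≈ x≈y) = mk≈ λ ε 0<ε →
    let N , close = x≈y ε 0<ε in
    N , λ n n≥ → ℚ.≤-trans (ℚ.≤-reflexive (dist-neg (seq x n) (seq y n))) (close n n≥)

  *-cong : ∀ {x x′ y y′} → x ≈ x′ → y ≈ y′ → x * y ≈ x′ * y′
  *-cong {x} {x′} {y} {y′} (mk≈ x≈x′) (mk≈ y≈y′) = mk≈ λ ε 0<ε →
    let A , 0<A , x≤A = bounded (seq x) (cauchy x)
        B , 0<B , y′≤B = bounded (seq y′) (cauchy y′)
        δ , 0<δ , [A+B]δ≡ε = divide (A ℚ.+ B) ε (0<+ (<⇒≤ 0<A) 0<B) 0<ε in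
    both (λ n (x≤ , y≤) (xx , yy) → weaken [A+B]δ≡ε
            (dist-* (seq x n) (seq y n) (seq x′ n) (seq y′ n) x≤ y≤ (<⇒≤ 0<δ) xx yy))
      (both (λ _ → _,_) x≤A y′≤B)
      (both (λ _ → _,_) (x≈x′ δ 0<δ) (y≈y′ δ 0<δ))

ℝ-commutativeRing : CommutativeRing 0ℓ 0ℓ
ℝ-commutativeRing = record
  { Carrier = ℝ ; _≈_ = _≈_ ; _+_ = _+_ ; _*_ = _*_ ; -_ = -_ ; 0# = 0ℝ ; 1# = 1ℝ
  ; isCommutativeRing = record
    { isRing = record
      { +-isAbelianGroup = record
        { isGroup = record
          { isMonoid = record
            { isSemigroup = record
              { isMagma = record
                { isEquivalence = record
                  { refl  = ≈-refl
                  ; sym   = ≈-sym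
                  ; trans = ≈-trans
                  }
                ; ∙-cong = +-cong
                }
              ; assoc = λ x y z → ≈-pointwise
                  λ n → ℚ.+-assoc (seq x n) (seq y n) (seq z n)
              }
            ; identity =
                (λ x → ≈-pointwise λ n → ℚ.+-identityˡ (seq x n)) ,
                (λ x → ≈-pointwise λ n → ℚ.+-identityʳ (seq x n))
            }
          ; inverse =
              (λ x → ≈-pointwise λ n → ℚ.+-inverseˡ (seq x n)) ,
              (λ x → ≈-pointwise λ n → ℚ.+-inverseʳ (seq x n))
          ; ⁻¹-cong = neg-cong
          }
        ; comm = λ x y → ≈-pointwise λ n → ℚ.+-comm (seq x n) (seq y n)
        }
      ; *-cong = *-cong
      ; *-assoc = λ x y z → ≈-pointwise
          λ n → ℚ.*-assoc (seq x n) (seq y n) (seq z n)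
      ; *-identity =
          (λ x → ≈-pointwise λ n → ℚ.*-identityˡ (seq x n)) ,
          (λ x → ≈-pointwise λ n → ℚ.*-identityʳ (seq x n))
      ; distrib =
          (λ x y z → ≈-pointwise
             λ n → ℚ.*-distribˡ-+ (seq x n) (seq y n) (seq z n)) ,
          (λ x y z → ≈-pointwise
             λ n → ℚ.*-distribʳ-+ (seq x n) (seq y n) (seq z n))
      }
    ; *-comm = λ x y → ≈-pointwise λ n → ℚ.*-comm (seq x n) (seq y n)
    }
  }

-- The value at 0 is irrelevant: a positive real has only finitely many
-- non-positive terms.
recip : ℚ → ℚ
recip p with p ℚ.≟ 0ℚ
... | yes _  = 0ℚ
... | no p≢0 = ℚ.1/_ p {{ℚ.≢-nonZero p≢0}}

private
  abstract
    recip-inverse : ∀ p → 0ℚ ℚ.< p → p ℚ.* recip p ≡ 1ℚ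
    recip-inverse p 0<p with p ℚ.≟ 0ℚ
    ... | yes p≡0 = contradiction (sym p≡0) (ℚ.<⇒≢ 0<p)
    ... | no p≢0  = ℚ.*-inverseʳ p {{ℚ.≢-nonZero p≢0}}

    recip-pos : ∀ p → 0ℚ ℚ.< p → 0ℚ ℚ.< recip p
    recip-pos p 0<p with p ℚ.≟ 0ℚ
    ... | yes p≡0 = contradiction (sym p≡0) (ℚ.<⇒≢ 0<p)
    ... | no p≢0  = ℚ.positive⁻¹ _ {{ℚ.1/pos⇒pos p {{ℚ.positive 0<p}}}}

    recip-≤ : ∀ p q → 0ℚ ℚ.< p → p ℚ.≤ q → recip q ℚ.≤ recip p
    recip-≤ p q 0<p p≤q = begin
      recip q                       ≡⟨ ℚ.*-identityʳ (recip q) ⟨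
      recip q ℚ.* 1ℚ                ≡⟨ cong (recip q ℚ.*_) (recip-inverse p 0<p) ⟨
      recip q ℚ.* (p ℚ.* recip p)   ≤⟨ *-monoˡ (recip q) (<⇒≤ (recip-pos q 0<q))
                                         (*-monoʳ (recip p) (<⇒≤ (recip-pos p 0<p)) p≤q) ⟩
      recip q ℚ.* (q ℚ.* recip p)   ≡⟨ solve 3 (λ a b c → a :* (b :* c) := (b :* a) :* c) refl (recip q) q (recip p) ⟩
      q ℚ.* recip q ℚ.* recip p     ≡⟨ cong (ℚ._* recip p) (recip-inverse q 0<q) ⟩
      1ℚ ℚ.* recip p                ≡⟨ ℚ.*-identityˡ (recip p) ⟩
      recip p                       ∎
      where
      open ℚ.≤-Reasoning
      0<q : 0ℚ ℚ.< q
      0<q = ℚ.<-≤-trans 0<p p≤q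

    diff-inverses : ∀ p p′ q q′ → p ℚ.* p′ ≡ 1ℚ → q ℚ.* q′ ≡ 1ℚ →
                    p′ ℚ.- q′ ≡ (p′ ℚ.* q′) ℚ.* (q ℚ.- p)
    diff-inverses p p′ q q′ pp′≡1 qq′≡1 = begin
      p′ ℚ.- q′                                 ≡⟨ cong₂ ℚ._-_ (ℚ.*-identityʳ p′) (ℚ.*-identityʳ q′) ⟨
      p′ ℚ.* 1ℚ ℚ.- q′ ℚ.* 1ℚ                   ≡⟨ cong₂ (λ u v → p′ ℚ.* u ℚ.- q′ ℚ.* v) qq′≡1 pp′≡1 ⟨
      p′ ℚ.* (q ℚ.* q′) ℚ.- q′ ℚ.* (p ℚ.* p′)   ≡⟨ solve 4 (λ a a′ b b′ → a′ :* (b :* b′) :- b′ :* (a :* a′)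
                                                     := (a′ :* b′) :* (b :- a)) refl p p′ q q′ ⟩
      (p′ ℚ.* q′) ℚ.* (q ℚ.- p)                 ∎
      where open ≡-Reasoning

    dist-inverses : ∀ p p′ q q′ {r δ} → p ℚ.* p′ ≡ 1ℚ → q ℚ.* q′ ≡ 1ℚ →
                    0ℚ ℚ.< p′ → 0ℚ ℚ.< q′ → p′ ℚ.≤ r → q′ ℚ.≤ r → 0ℚ ℚ.≤ δ →
                    ∣ p ℚ.- q ∣ ℚ.≤ δ → ∣ p′ ℚ.- q′ ∣ ℚ.≤ (r ℚ.* r) ℚ.* δ
    dist-inverses p p′ q q′ {r} {δ} pp′≡1 qq′≡1 0<p′ 0<q′ p′≤r q′≤r 0≤δ close = begin
      ∣ p′ ℚ.- q′ ∣                    ≡⟨ cong ∣_∣ (diff-inverses p p′ q q′ pp′≡1 qq′≡1) ⟩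
      ∣ (p′ ℚ.* q′) ℚ.* (q ℚ.- p) ∣    ≡⟨ ℚ.∣p*q∣≡∣p∣*∣q∣ (p′ ℚ.* q′) (q ℚ.- p) ⟩
      ∣ p′ ℚ.* q′ ∣ ℚ.* ∣ q ℚ.- p ∣    ≡⟨ cong₂ ℚ._*_ (ℚ.0≤p⇒∣p∣≡p (<⇒≤ (0<* 0<p′ 0<q′))) (dist-sym q p) ⟩
      (p′ ℚ.* q′) ℚ.* ∣ p ℚ.- q ∣      ≤⟨ *-monoˡ (p′ ℚ.* q′) (<⇒≤ (0<* 0<p′ 0<q′)) close ⟩
      (p′ ℚ.* q′) ℚ.* δ                ≤⟨ *-monoʳ δ 0≤δ (*-monoʳ q′ (<⇒≤ 0<q′) p′≤r) ⟩
      (r ℚ.* q′) ℚ.* δ                 ≤⟨ *-monoʳ δ 0≤δ (*-monoˡ r (ℚ.≤-trans (<⇒≤ 0<p′) p′≤r) q′≤r) ⟩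
      (r ℚ.* r) ℚ.* δ                  ∎
      where open ℚ.≤-Reasoning

    dist-recip : ∀ {b δ} p q → 0ℚ ℚ.< b → b ℚ.≤ p → b ℚ.≤ q → 0ℚ ℚ.≤ δ →
                 ∣ p ℚ.- q ∣ ℚ.≤ δ →
                 ∣ recip p ℚ.- recip q ∣ ℚ.≤ (recip b ℚ.* recip b) ℚ.* δ
    dist-recip {b} p q 0<b b≤p b≤q =
      dist-inverses p (recip p) q (recip q)
        (recip-inverse p 0<p) (recip-inverse q 0<q) (recip-pos p 0<p) (recip-pos q 0<q)
        (recip-≤ b p 0<b b≤p) (recip-≤ b q 0<b b≤q)
      where
      0<p : 0ℚ ℚ.< p
      0<p = ℚ.<-≤-trans 0<b b≤p
      0<q : 0ℚ ℚ.< q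
      0<q = ℚ.<-≤-trans 0<b b≤q

    recip-cauchy : ∀ x → 0ℝ < x → Cauchy (λ n → recip (seq x n))
    recip-cauchy x (mk< b 0<b (N , b≤x)) ε 0<ε =
      let r = recip b
          0<r = recip-pos b 0<b
          δ , 0<δ , rrδ≡ε = divide (r ℚ.* r) ε (0<* 0<r 0<r) 0<ε
          N′ , close = cauchy x δ 0<δ
          b≤ : ∀ n → N ℕ.≤ n → b ℚ.≤ seq x n
          b≤ n n≥ = subst (ℚ._≤ seq x n) (ℚ.+-identityˡ b) (b≤x n n≥)
      in N ℕ.⊔ N′ , λ m n m≥ n≥ → weaken rrδ≡ε (dist-recip (seq x m) (seq x n) 0<b
        (b≤ m (ℕ.m⊔n≤o⇒m≤o N N′ m≥))
        (b≤ n (ℕ.m⊔n≤o⇒m≤o N N′ n≥))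
        (<⇒≤ 0<δ)
        (close m n (ℕ.m⊔n≤o⇒n≤o N N′ m≥) (ℕ.m⊔n≤o⇒n≤o N N′ n≥)))

1/ : (x : ℝ) → 0ℝ < x → ℝ
seq    (1/ x 0<x) n = recip (seq x n)
cauchy (1/ x 0<x)   = recip-cauchy x 0<x

*-1/-inverse : ∀ x (0<x : 0ℝ < x) → x * 1/ x 0<x ≈ 1ℝ
*-1/-inverse x (mk< b 0<b (N , b≤x)) = mk≈ λ ε 0<ε → N , λ n n≥ → ℚ.≤-trans
  (ℚ.≤-reflexive (trans
    (cong (λ p → ∣ p ℚ.- 1ℚ ∣)
      (recip-inverse (seq x n) (ℚ.<-≤-trans (0<+ ℚ.≤-refl 0<b) (b≤x n n≥))))
    (dist-refl 1ℚ)))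
  (<⇒≤ 0<ε)

open SemiringSum (CommutativeRing.semiring ℝ-commutativeRing) public using (sum)

infix  4 _≥ᵛ_
infixl 6 _+ᵛ_
infixr 7 _*ᵐ_ _*ᵛ_
infix  7 _∙_

Matrix : ℕ → ℕ → Set
Matrix m n = Vector (Vector ℝ n) m

_≥ᵛ_ : ∀ {n} → Vector ℝ n → Vector ℝ n → Set
_≥ᵛ_ = Pointwise _≥_

0ᵛ e : ∀ {n} → Vector ℝ n
0ᵛ = replicate _ 0ℝ
e  = replicate _ 1ℝ

_+ᵛ_ : ∀ {n} → Vector ℝ n → Vector ℝ n → Vector ℝ n
_+ᵛ_ = zipWith _+_

_*ᵛ_ : ∀ {n} → Vector ℝ n → ℝ → Vector ℝ n
v *ᵛ c = map (_* c) v

_∙_ : ∀ {n} → Vector ℝ n → Vector ℝ n → ℝ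
u ∙ v = sum (zipWith _*_ u v)

_*ᵐ_ : ∀ {m n} → Matrix m n → Vector ℝ n → Vector ℝ m
A *ᵐ x = map (_∙ x) A

SOL : ∀ {m} → Vector ℝ m → Matrix m m → Pred (Vector ℝ m) 0ℓ
SOL q M z = (q +ᵛ M *ᵐ z ≥ᵛ 0ᵛ) × (z ≥ᵛ 0ᵛ) × (z ∙ (q +ᵛ M *ᵐ z) ≈ 0ℝ)

SNE : ∀ {n} → Matrix n n → Pred (Vector ℝ n) 0ℓ
SNE C x = (C *ᵐ x ≥ᵛ e *ᵛ (x ∙ (C *ᵐ x))) × (x ≥ᵛ 0ᵛ) × (e ∙ x ≈ 1ℝ)

C[_,_] : ∀ {m} → Vector ℝ m → Matrix m m → Matrix (m ℕ.+ 1) (m ℕ.+ 1)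
C[ q , M ] = zipWith (λ row b → row ++ (b ∷ [])) M (q +ᵛ e) ++ ((0ᵛ ++ (1ℝ ∷ [])) ∷ [])

[_⨾_] : ∀ {m} → Vector ℝ m → ℝ → Vector ℝ (m ℕ.+ 1)
[ y ⨾ t ] = y ++ (t ∷ [])

-- An element [ y ⨾ t ] of ℝ^(m+1) is given by its two blocks.
SNE₊ : ∀ {m} → Matrix (m ℕ.+ 1) (m ℕ.+ 1) → Pred (Vector ℝ m × ℝ) 0ℓ
SNE₊ C (y , t) = [ y ⨾ t ] ∈ SNE C × 0ℝ < t

private
  abstract
    ≥-refl : ∀ {x} → x ≥ x
    ≥-refl {x} = mk≤ λ ε 0<ε → 0 , λ n _ →
      subst (ℚ._≤ seq x n ℚ.+ ε) (ℚ.+-identityʳ (seq x n)) (ℚ.+-monoʳ-≤ (seq x n) (<⇒≤ 0<ε))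

    +-nonneg : ∀ {x y} → x ≥ 0ℝ → y ≥ 0ℝ → x + y ≥ 0ℝ
    +-nonneg {x} {y} (mk≤ x≥0) (mk≤ y≥0) = mk≤ λ ε 0<ε →
      let δ , 0<δ , δ+δ≡ε = halve ε 0<ε in
      both (λ n p q → weaken
             (trans (solve 3 (λ a b d → (a :+ d) :+ (b :+ d) := (a :+ b) :+ (d :+ d))
                       refl (seq x n) (seq y n) δ)
                    (cong (seq x n ℚ.+ seq y n ℚ.+_) δ+δ≡ε))
             (ℚ.+-mono-≤ p q))
        (x≥0 δ 0<δ) (y≥0 δ 0<δ)

    sum-nonneg : ∀ {n} (v : Vector ℝ n) → v ≥ᵛ 0ᵛ → sum v ≥ 0ℝ
    sum-nonneg {zero}  v v≥0 = ≥-refl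
    sum-nonneg {suc n} v v≥0 = +-nonneg (v≥0 zero) (sum-nonneg (λ i → v (suc i)) λ i → v≥0 (suc i))

    1*-nonneg : ∀ {x} → x ≥ 0ℝ → 1ℝ * x ≥ 0ℝ
    1*-nonneg {x} (mk≤ x≥0) = mk≤ λ ε 0<ε →
      let N , h = x≥0 ε 0<ε in
      N , λ n n≥ → subst (λ p → 0ℚ ℚ.≤ p ℚ.+ ε) (sym (ℚ.*-identityˡ (seq x n))) (h n n≥)

    +1-pos : ∀ {x} → x ≥ 0ℝ → 0ℝ < x + 1ℝ
    +1-pos {x} (mk≤ x≥0) =
      let N , h = x≥0 ½ 0<½ in
      mk< ½ 0<½ (N , λ n n≥ → shift (seq x n) (h n n≥))
      where
      shift : ∀ p → 0ℚ ℚ.≤ p ℚ.+ ½ → 0ℚ ℚ.+ ½ ℚ.≤ p ℚ.+ 1ℚ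
      shift p 0≤p+½ = weaken (ℚ.+-assoc p ½ ½) (ℚ.+-monoˡ-≤ ½ 0≤p+½)

e∙z+1-pos : ∀ {n} {z : Vector ℝ n} → z ≥ᵛ 0ᵛ → 0ℝ < e ∙ z + 1ℝ
e∙z+1-pos {z = z} z≥0 = +1-pos (sum-nonneg (zipWith _*_ e z) λ i → 1*-nonneg (z≥0 i))

{-# OPTIONS --safe #-}

-- Put w = M y + t q and c = yᵀ w.  When eᵀ y + t = 1, the vector x = (y , t)
-- has C x = (w + t e , t) and xᵀ C x = c + t, so the equilibrium condition
-- reads w ≥ c e and 0 ≥ c.  Averaging w ≥ c e with the weights y gives
-- c ≥ (eᵀ y) c = (1 − t) c, hence t c ≥ 0 and, for t > 0, c = 0.  So the
-- condition is w ≥ 0, yᵀ w = 0, which is invariant under positive scaling of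
-- (y , t); t = 1 is the complementarity problem.
module Submission where

open import Defs
open import Algebra.Bundles using (CommutativeRing)
import Algebra.Properties.CommutativeMonoid.Sum as CommutativeMonoidSum
import Algebra.Properties.Group as GroupProperties
import Algebra.Properties.Semiring.Sum as SemiringSum
import Algebra.Solver.Ring.NaturalCoefficients.Default as NaturalCoefficients
open import Data.Fin using (Fin; zero; suc; _↑ˡ_; _↑ʳ_)
open import Data.Nat using (ℕ)
import Data.Nat as ℕ
import Data.Nat.Properties as ℕ
open import Data.Product using (∃; _×_; _,_; proj₁; proj₂)
open import Data.Rational as ℚ using (ℚ; 0ℚ; 1ℚ; ½; ∣_∣)
import Data.Rational.Properties as ℚ
open import Data.Rational.Solver using (module +-*-Solver)
open import Data.Sum using (inj₁; inj₂)
open import Data.Vec.Functional using (Vector; []; _∷_; _++_; replicate; zipWith)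
open import Data.Vec.Functional.Properties using (lookup-++ˡ; lookup-++ʳ)
open import Function using (_∘_)
open import Relation.Binary.Bundles using (Poset)
open import Relation.Binary.PropositionalEquality as ≡ using (_≡_; refl)
import Relation.Binary.Reasoning.PartialOrder as PosetReasoning
open import Relation.Nullary using (yes; no; contradiction)
open import Relation.Unary using (_∈_)

module R = CommutativeRing ℝ-commutativeRing

-- Eventual properties of sequences and inequalities between rationals

zipWith-eventually : ∀ {P Q R : ℕ → Set} → (∀ n → P n → Q n → R n) →
                     Eventually P → Eventually Q → Eventually R
zipWith-eventually f (N , p) (N′ , q) = N ℕ.⊔ N′ , λ n n≥ →
  f n (p n (ℕ.m⊔n≤o⇒m≤o N N′ n≥)) (q n (ℕ.m⊔n≤o⇒n≤o N N′ n≥))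

p≤∣p∣ : ∀ p → p ℚ.≤ ∣ p ∣
p≤∣p∣ p with ℚ.≤-total 0ℚ p
... | inj₁ 0≤p = ℚ.≤-reflexive (≡.sym (ℚ.0≤p⇒∣p∣≡p 0≤p))
... | inj₂ p≤0 = ℚ.≤-trans p≤0 (ℚ.0≤∣p∣ p)

open +-*-Solver using (solve; con; _:=_; _:+_; _:*_; :-_; _:-_)

∣p-q∣≤r⇒p≤q+r : ∀ p q {r} → ∣ p ℚ.- q ∣ ℚ.≤ r → p ℚ.≤ q ℚ.+ r
∣p-q∣≤r⇒p≤q+r p q {r} ∣p-q∣≤r = begin
  p                 ≡⟨ solve 2 (λ a b → a := b :+ (a :- b)) refl p q ⟩
  q ℚ.+ (p ℚ.- q)   ≤⟨ ℚ.+-monoʳ-≤ q (ℚ.≤-trans (p≤∣p∣ (p ℚ.- q)) ∣p-q∣≤r) ⟩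
  q ℚ.+ r           ∎
  where open ℚ.≤-Reasoning

p≤q+r⇒p-q≤r : ∀ p q {r} → p ℚ.≤ q ℚ.+ r → p ℚ.- q ℚ.≤ r
p≤q+r⇒p-q≤r p q {r} p≤q+r = begin
  p ℚ.- q           ≤⟨ ℚ.+-monoˡ-≤ (ℚ.- q) p≤q+r ⟩
  q ℚ.+ r ℚ.- q     ≡⟨ solve 2 (λ a b → a :+ b :- a := b) refl q r ⟩
  r                 ∎
  where open ℚ.≤-Reasoning

p≤q+r∧q≤p+r⇒∣p-q∣≤r : ∀ p q {r} → p ℚ.≤ q ℚ.+ r → q ℚ.≤ p ℚ.+ r → ∣ p ℚ.- q ∣ ℚ.≤ r
p≤q+r∧q≤p+r⇒∣p-q∣≤r p q {r} p≤q+r q≤p+r with ℚ.∣p∣≡p∨∣p∣≡-p (p ℚ.- q)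
... | inj₁ eq = ≡.subst (ℚ._≤ r) (≡.sym eq) (p≤q+r⇒p-q≤r p q p≤q+r)
... | inj₂ eq = ≡.subst (ℚ._≤ r)
  (≡.sym (≡.trans eq (solve 2 (λ a b → :- (a :- b) := b :- a) refl p q)))
  (p≤q+r⇒p-q≤r q p q≤p+r)

+-pos : ∀ {p q} → 0ℚ ℚ.≤ p → 0ℚ ℚ.< q → 0ℚ ℚ.< p ℚ.+ q
+-pos {p} {q} 0≤p 0<q = ≡.subst (ℚ._< p ℚ.+ q) (ℚ.+-identityˡ 0ℚ) (ℚ.+-mono-≤-< 0≤p 0<q)

*-pos : ∀ {p q} → 0ℚ ℚ.< p → 0ℚ ℚ.< q → 0ℚ ℚ.< p ℚ.* q
*-pos {p} {q} 0<p 0<q =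
  ≡.subst (ℚ._< p ℚ.* q) (ℚ.*-zeroʳ p) (ℚ.*-monoʳ-<-pos p {{ℚ.positive 0<p}} 0<q)

recip-inverse : ∀ {p} → 0ℚ ℚ.< p → p ℚ.* recip p ≡ 1ℚ
recip-inverse {p} 0<p with p ℚ.≟ 0ℚ
... | yes p≡0 = contradiction (≡.sym p≡0) (ℚ.<⇒≢ 0<p)
... | no p≢0  = ℚ.*-inverseʳ p {{ℚ.≢-nonZero p≢0}}

recip-pos : ∀ {p} → 0ℚ ℚ.< p → 0ℚ ℚ.< recip p
recip-pos {p} 0<p with p ℚ.≟ 0ℚ
... | yes p≡0 = contradiction (≡.sym p≡0) (ℚ.<⇒≢ 0<p)
... | no p≢0  = ℚ.positive⁻¹ _ {{ℚ.1/pos⇒pos p {{ℚ.positive 0<p}}}}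

-- Multiply `p ≤ q` by the nonnegative `recip p` and `recip q`, then cancel on each side.
recip-anti-≤ : ∀ {p q} → 0ℚ ℚ.< p → p ℚ.≤ q → recip q ℚ.≤ recip p
recip-anti-≤ {p} {q} 0<p p≤q = begin
  recip q                       ≡⟨ ℚ.*-identityˡ (recip q) ⟨
  1ℚ ℚ.* recip q                ≡⟨ ≡.cong (ℚ._* recip q) (recip-inverse 0<p) ⟨
  p ℚ.* recip p ℚ.* recip q     ≤⟨ ℚ.*-monoʳ-≤-nonNeg (recip q) {{nonNeg 0<q}}
                                     (ℚ.*-monoʳ-≤-nonNeg (recip p) {{nonNeg 0<p}} p≤q) ⟩
  q ℚ.* recip p ℚ.* recip q     ≡⟨ solve 3 (λ a b c → a :* b :* c := b :* (a :* c)) refl q (recip p) (recip q) ⟩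
  recip p ℚ.* (q ℚ.* recip q)   ≡⟨ ≡.cong (recip p ℚ.*_) (recip-inverse 0<q) ⟩
  recip p ℚ.* 1ℚ                ≡⟨ ℚ.*-identityʳ (recip p) ⟩
  recip p                       ∎
  where
  open ℚ.≤-Reasoning
  0<q : 0ℚ ℚ.< q
  0<q = ℚ.<-≤-trans 0<p p≤q
  nonNeg : ∀ {r} → 0ℚ ℚ.< r → ℚ.NonNegative (recip r)
  nonNeg 0<r = ℚ.nonNegative (ℚ.<⇒≤ (recip-pos 0<r))

halve : ∀ ε → 0ℚ ℚ.< ε → ∃ λ δ → 0ℚ ℚ.< δ × δ ℚ.+ δ ≡ ε
halve ε 0<ε = ½ ℚ.* ε , *-pos (ℚ.positive⁻¹ ½) 0<ε ,
  solve 1 (λ e → con ½ :* e :+ con ½ :* e := e) refl ε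

divide : ∀ k ε → 0ℚ ℚ.< k → 0ℚ ℚ.< ε → ∃ λ δ → 0ℚ ℚ.< δ × k ℚ.* δ ≡ ε
divide k ε 0<k 0<ε = recip k ℚ.* ε , *-pos (recip-pos 0<k) 0<ε ,
  ≡.trans (≡.sym (ℚ.*-assoc k (recip k) ε))
    (≡.trans (≡.cong (ℚ._* ε) (recip-inverse 0<k)) (ℚ.*-identityˡ ε))

bounded-above : ∀ x → ∃ λ B → 0ℚ ℚ.< B × Eventually λ n → seq x n ℚ.≤ B
bounded-above x =
  let N , close = cauchy x 1ℚ (ℚ.positive⁻¹ 1ℚ) in
  -- From `N` on, all terms lie within 1 of `seq x N`. The absolute value makes the bound positive,
  -- so that it may serve as a divisor.
  ∣ seq x N ∣ ℚ.+ 1ℚ , +-pos (ℚ.0≤∣p∣ (seq x N)) (ℚ.positive⁻¹ 1ℚ) , N , λ n n≥ → ℚ.≤-trans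
    (∣p-q∣≤r⇒p≤q+r (seq x n) (seq x N) (close n N n≥ ℕ.≤-refl))
    (ℚ.+-monoˡ-≤ 1ℚ (p≤∣p∣ (seq x N)))

-- Order on ℝ

≤-reflexive : ∀ {x y} → x ≈ y → x ≤ y
≤-reflexive {x} {y} (mk≈ x≈y) = mk≤ λ ε 0<ε →
  let N , close = x≈y ε 0<ε in
  N , λ n n≥ → ∣p-q∣≤r⇒p≤q+r (seq x n) (seq y n) (close n n≥)

≤-trans : ∀ {x y z} → x ≤ y → y ≤ z → x ≤ z
≤-trans {x} {y} {z} (mk≤ x≤y) (mk≤ y≤z) = mk≤ λ ε 0<ε →
  let δ , 0<δ , δ+δ≡ε = halve ε 0<ε in
  zipWith-eventually
    (λ n p q → ≡.subst (seq x n ℚ.≤_)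
      (≡.trans (ℚ.+-assoc (seq z n) δ δ) (≡.cong (seq z n ℚ.+_) δ+δ≡ε))
      (ℚ.≤-trans p (ℚ.+-monoˡ-≤ δ q)))
    (x≤y δ 0<δ) (y≤z δ 0<δ)

≤-antisym : ∀ {x y} → x ≤ y → y ≤ x → x ≈ y
≤-antisym {x} {y} (mk≤ x≤y) (mk≤ y≤x) = mk≈ λ ε 0<ε →
  zipWith-eventually (λ n → p≤q+r∧q≤p+r⇒∣p-q∣≤r (seq x n) (seq y n)) (x≤y ε 0<ε) (y≤x ε 0<ε)

≤-poset : Poset _ _ _
≤-poset = record
  { isPartialOrder = record
    { isPreorder = record
      { isEquivalence = R.isEquivalence
      ; reflexive     = ≤-reflexive
      ; trans         = ≤-trans
      }
    ; antisym = ≤-antisym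
    }
  }

module ≤-Reasoning = PosetReasoning ≤-poset

+-mono-≤ : ∀ {x y u v} → x ≤ y → u ≤ v → x + u ≤ y + v
+-mono-≤ {x} {y} {u} {v} (mk≤ x≤y) (mk≤ u≤v) = mk≤ λ ε 0<ε →
  let δ , 0<δ , δ+δ≡ε = halve ε 0<ε in
  zipWith-eventually
    (λ n p q → ≡.subst (seq x n ℚ.+ seq u n ℚ.≤_)
      (≡.trans
        (solve 3 (λ a b d → (a :+ d) :+ (b :+ d) := (a :+ b) :+ (d :+ d)) refl (seq y n) (seq v n) δ)
        (≡.cong (seq y n ℚ.+ seq v n ℚ.+_) δ+δ≡ε))
      (ℚ.+-mono-≤ p q))
    (x≤y δ 0<δ) (u≤v δ 0<δ)

+-cancelʳ-≤ : ∀ z {x y} → x + z ≤ y + z → x ≤ y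
+-cancelʳ-≤ z {x} {y} x+z≤y+z = begin
  x               ≈⟨ cancel x ⟨
  x + z + - z     ≤⟨ +-mono-≤ x+z≤y+z (≤-reflexive R.refl) ⟩
  y + z + - z     ≈⟨ cancel y ⟩
  y               ∎
  where
  open ≤-Reasoning
  cancel : ∀ w → w + z + - z ≈ w
  cancel w = GroupProperties.//-rightDividesʳ R.+-group z w

-- The tolerance δ₁ of x is scaled by the bound B of y; that of y by the
-- bound A + δ₁ of x + δ₁, which avoids a δ₁δ₂ term.
*-nonneg : ∀ {x y} → 0ℝ ≤ x → 0ℝ ≤ y → 0ℝ ≤ x * y
*-nonneg {x} {y} (mk≤ 0≤x) (mk≤ 0≤y) = mk≤ λ ε 0<ε →
  let A , 0<A , x≤A = bounded-above x
      B , 0<B , y≤B = bounded-above y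
      δ , 0<δ , δ+δ≡ε = halve ε 0<ε
      δ₁ , 0<δ₁ , Bδ₁≡δ = divide B δ 0<B 0<δ
      δ₂ , 0<δ₂ , [A+δ₁]δ₂≡δ = divide (A ℚ.+ δ₁) δ (+-pos (ℚ.<⇒≤ 0<A) 0<δ₁) 0<δ in
  zipWith-eventually
    (λ n (0≤a+δ₁ , a≤A) (0≤b+δ₂ , b≤B) → ≡.subst (λ r → 0ℚ ℚ.≤ seq x n ℚ.* seq y n ℚ.+ r)
      (≡.trans (≡.cong₂ ℚ._+_ Bδ₁≡δ [A+δ₁]δ₂≡δ) δ+δ≡ε)
      (estimate (seq x n) (seq y n) 0<δ₁ 0<δ₂ 0≤a+δ₁ a≤A 0≤b+δ₂ b≤B))
    (zipWith-eventually (λ _ → _,_) (0≤x δ₁ 0<δ₁) x≤A)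
    (zipWith-eventually (λ _ → _,_) (0≤y δ₂ 0<δ₂) y≤B)
  where
  -- The shifted factors `a + δ₁` and `b + δ₂` are nonnegative. Their product is `a * b` plus an
  -- error, which the bounds on `a` and `b` control.
  estimate : ∀ a b {A B δ₁ δ₂} → 0ℚ ℚ.< δ₁ → 0ℚ ℚ.< δ₂ →
             0ℚ ℚ.≤ a ℚ.+ δ₁ → a ℚ.≤ A → 0ℚ ℚ.≤ b ℚ.+ δ₂ → b ℚ.≤ B →
             0ℚ ℚ.≤ a ℚ.* b ℚ.+ (B ℚ.* δ₁ ℚ.+ (A ℚ.+ δ₁) ℚ.* δ₂)
  estimate a b {A} {B} {δ₁} {δ₂} 0<δ₁ 0<δ₂ 0≤a+δ₁ a≤A 0≤b+δ₂ b≤B = begin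
    0ℚ
      ≡⟨ ℚ.*-zeroʳ (a ℚ.+ δ₁) ⟨
    (a ℚ.+ δ₁) ℚ.* 0ℚ
      ≤⟨ ℚ.*-monoˡ-≤-nonNeg (a ℚ.+ δ₁) {{ℚ.nonNegative 0≤a+δ₁}} 0≤b+δ₂ ⟩
    (a ℚ.+ δ₁) ℚ.* (b ℚ.+ δ₂)
      ≡⟨ solve 4 (λ a b c d → (a :+ c) :* (b :+ d) := a :* b :+ (b :* c :+ (a :+ c) :* d))
           refl a b δ₁ δ₂ ⟩
    a ℚ.* b ℚ.+ (b ℚ.* δ₁ ℚ.+ (a ℚ.+ δ₁) ℚ.* δ₂)
      ≤⟨ ℚ.+-monoʳ-≤ (a ℚ.* b) (ℚ.+-mono-≤
           (ℚ.*-monoʳ-≤-nonNeg δ₁ {{ℚ.nonNegative (ℚ.<⇒≤ 0<δ₁)}} b≤B)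
           (ℚ.*-monoʳ-≤-nonNeg δ₂ {{ℚ.nonNegative (ℚ.<⇒≤ 0<δ₂)}} (ℚ.+-monoˡ-≤ δ₁ a≤A))) ⟩
    a ℚ.* b ℚ.+ (B ℚ.* δ₁ ℚ.+ (A ℚ.+ δ₁) ℚ.* δ₂)
      ∎
    where open ℚ.≤-Reasoning

-- This is `*-nonneg` for `x` and `z - y`, with `x * y` added back.
*-monoˡ-≤ : ∀ {x y z} → 0ℝ ≤ x → y ≤ z → x * y ≤ x * z
*-monoˡ-≤ {x} {y} {z} 0≤x y≤z = begin
  x * y                     ≈⟨ R.+-identityˡ (x * y) ⟨
  0ℝ + x * y                ≤⟨ +-mono-≤ (*-nonneg 0≤x 0≤z-y) (≤-reflexive R.refl) ⟩
  x * (z + - y) + x * y     ≈⟨ R.distribˡ x (z + - y) y ⟨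
  x * (z + - y + y)         ≈⟨ R.*-congˡ (GroupProperties.//-rightDividesˡ R.+-group y z) ⟩
  x * z                     ∎
  where
  open ≤-Reasoning
  0≤z-y : 0ℝ ≤ z + - y
  0≤z-y = begin
    0ℝ        ≈⟨ R.-‿inverseʳ y ⟨
    y + - y   ≤⟨ +-mono-≤ y≤z (≤-reflexive R.refl) ⟩
    z + - y   ∎

<⇒≤ : ∀ {x y} → x < y → x ≤ y
<⇒≤ {x} {y} (mk< g 0<g (N , sep)) = mk≤ λ ε 0<ε → N , λ n n≥ → begin
  seq x n           ≡⟨ ℚ.+-identityʳ (seq x n) ⟨
  seq x n ℚ.+ 0ℚ    ≤⟨ ℚ.+-monoʳ-≤ (seq x n) (ℚ.<⇒≤ 0<g) ⟩
  seq x n ℚ.+ g     ≤⟨ sep n n≥ ⟩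
  seq y n           ≡⟨ ℚ.+-identityʳ (seq y n) ⟨
  seq y n ℚ.+ 0ℚ    ≤⟨ ℚ.+-monoʳ-≤ (seq y n) (ℚ.<⇒≤ 0<ε) ⟩
  seq y n ℚ.+ ε     ∎
  where open ℚ.≤-Reasoning

-- An upper bound `B` on the tail of `x` bounds the reciprocals of its positive terms below by
-- `recip B`, which is the required gap.
1/-pos : ∀ x (0<x : 0ℝ < x) → 0ℝ < 1/ x 0<x
1/-pos x (mk< g 0<g sep) =
  let B , 0<B , x≤B = bounded-above x in
  mk< (recip B) (recip-pos 0<B) (zipWith-eventually
    (λ n 0+g≤x x≤B → ≡.subst (ℚ._≤ recip (seq x n)) (≡.sym (ℚ.+-identityˡ (recip B)))
      (recip-anti-≤ (ℚ.<-≤-trans (+-pos ℚ.≤-refl 0<g) 0+g≤x) x≤B))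
    sep x≤B)

module Sum = SemiringSum R.semiring
module CSum = CommutativeMonoidSum R.+-commutativeMonoid
module S = NaturalCoefficients R.commutativeSemiring

-- Dot products

∙-congʳ : ∀ {n} (u : Vector ℝ n) {v w} → (∀ i → v i ≈ w i) → u ∙ v ≈ u ∙ w
∙-congʳ u v≈w = Sum.sum-cong-≋ λ i → R.*-congˡ (v≈w i)

∙-distribˡ-+ : ∀ {n} (u v w : Vector ℝ n) → u ∙ (v +ᵛ w) ≈ u ∙ v + u ∙ w
∙-distribˡ-+ u v w = R.trans
  (Sum.sum-cong-≋ λ i → R.distribˡ (u i) (v i) (w i))
  (CSum.∑-distrib-+ (zipWith _*_ u v) (zipWith _*_ u w))

∙-*ᵛ : ∀ {n} (u v : Vector ℝ n) s → u ∙ (v *ᵛ s) ≈ (u ∙ v) * s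
∙-*ᵛ u v s = R.trans
  (Sum.sum-cong-≋ λ i → R.sym (R.*-assoc (u i) (v i) s))
  (R.sym (Sum.*-distribʳ-sum s (zipWith _*_ u v)))

*ᵛ-∙ : ∀ {n} (u v : Vector ℝ n) s → (u *ᵛ s) ∙ v ≈ (u ∙ v) * s
*ᵛ-∙ u v s = R.trans
  (Sum.sum-cong-≋ λ i → S.solve 3 (λ a b c → (a S.:* c) S.:* b S.:= (a S.:* b) S.:* c) R.refl (u i) (v i) s)
  (R.sym (Sum.*-distribʳ-sum s (zipWith _*_ u v)))

-- Writing the total weight as `e ∙ u` lets the normalisation `e ∙ y + t ≈ 1ℝ` act on the result.
∙-replicate : ∀ {n} (u : Vector ℝ n) s → u ∙ replicate n s ≈ (e ∙ u) * s
∙-replicate u s = R.trans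
  (Sum.sum-cong-≋ λ i → R.*-congʳ (R.sym (R.*-identityˡ (u i))))
  (R.sym (Sum.*-distribʳ-sum s (zipWith _*_ e u)))

0ᵛ-∙ : ∀ {n} (u : Vector ℝ n) → 0ᵛ ∙ u ≈ 0ℝ
0ᵛ-∙ {n} u = R.trans (Sum.sum-cong-≋ λ i → R.zeroˡ (u i)) (Sum.sum-replicate-zero n)

sum-mono-≤ : ∀ {n} {u v : Vector ℝ n} → (∀ i → u i ≤ v i) → sum u ≤ sum v
sum-mono-≤ {ℕ.zero}  u≤v = ≤-reflexive R.refl
sum-mono-≤ {ℕ.suc n} u≤v = +-mono-≤ (u≤v zero) (sum-mono-≤ (u≤v ∘ suc))

∙-monoˡ-≤ : ∀ {n} {u v w : Vector ℝ n} → u ≥ᵛ 0ᵛ → (∀ i → v i ≤ w i) → u ∙ v ≤ u ∙ w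
∙-monoˡ-≤ u≥0 v≤w = sum-mono-≤ λ i → *-monoˡ-≤ (u≥0 i) (v≤w i)

-- The weights `y` have total mass `1 - t`. To avoid subtraction, `c` is split as
-- `t * c + (e ∙ y) * c`, and averaging bounds the second summand by `c`.
nonneg-of-weighted-min : ∀ {n} (y w : Vector ℝ n) t (0<t : 0ℝ < t) → y ≥ᵛ 0ᵛ → e ∙ y + t ≈ 1ℝ →
                         (∀ i → y ∙ w ≤ w i) → 0ℝ ≤ y ∙ w
nonneg-of-weighted-min {n} y w t 0<t y≥0 e∙y+t≈1 c≤w = begin
  -- Division of `t * c ≥ 0` by `t` is multiplication by `s`.
  0ℝ            ≤⟨ *-nonneg (<⇒≤ (1/-pos t 0<t)) 0≤tc ⟩
  s * (t * c)   ≈⟨ S.solve 3 (λ a b d → a S.:* (b S.:* d) S.:= (b S.:* a) S.:* d) R.refl s t c ⟩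
  t * s * c     ≈⟨ R.*-congʳ (*-1/-inverse t 0<t) ⟩
  1ℝ * c        ≈⟨ R.*-identityˡ c ⟩
  c             ∎
  where
  open ≤-Reasoning
  c s : ℝ
  c = y ∙ w
  s = 1/ t 0<t

  0≤tc : 0ℝ ≤ t * c
  0≤tc = +-cancelʳ-≤ c (begin
    0ℝ + c                      ≈⟨ R.+-identityˡ c ⟩
    c                           ≈⟨ R.*-identityˡ c ⟨
    1ℝ * c                      ≈⟨ R.*-congʳ e∙y+t≈1 ⟨
    (e ∙ y + t) * c             ≈⟨ R.*-congʳ (R.+-comm (e ∙ y) t) ⟩
    (t + e ∙ y) * c             ≈⟨ R.distribʳ c t (e ∙ y) ⟩
    t * c + (e ∙ y) * c         ≈⟨ R.+-congˡ (∙-replicate y c) ⟨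
    t * c + y ∙ replicate n c   ≤⟨ +-mono-≤ (≤-reflexive R.refl) (∙-monoˡ-≤ y≥0 c≤w) ⟩
    t * c + c                   ∎)

-- Vectors with one appended entry

-- For variable `m` the type `Fin (m + 1)` does not unfold to a successor, so the last index is
-- reached by recursion on `m`.
snoc-elim : ∀ {m} (P : Fin (m ℕ.+ 1) → Set) → (∀ i → P (i ↑ˡ 1)) → P (m ↑ʳ zero) → ∀ j → P j
snoc-elim {ℕ.zero}  P init last zero    = last
snoc-elim {ℕ.suc m} P init last zero    = init zero
snoc-elim {ℕ.suc m} P init last (suc j) = snoc-elim (P ∘ suc) (init ∘ suc) last j

sum-snoc : ∀ {m} (f : Vector ℝ (m ℕ.+ 1)) → sum f ≈ sum (λ i → f (i ↑ˡ 1)) + f (m ↑ʳ zero)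
-- The left side unfolds to `f zero + 0ℝ`, the right side to `0ℝ + f zero`.
sum-snoc {ℕ.zero}  f = R.+-comm (f zero) 0ℝ
sum-snoc {ℕ.suc m} f = R.trans (R.+-congˡ (sum-snoc (f ∘ suc)))
  (R.sym (R.+-assoc (f zero) (sum (λ i → f (suc (i ↑ˡ 1)))) (f (suc (m ↑ʳ zero)))))

⨾-init : ∀ {m} (y : Vector ℝ m) t i → [ y ⨾ t ] (i ↑ˡ 1) ≡ y i
⨾-init y t = lookup-++ˡ y (t ∷ [])

⨾-last : ∀ {m} (y : Vector ℝ m) t → [ y ⨾ t ] (m ↑ʳ zero) ≡ t
⨾-last y t = lookup-++ʳ y (t ∷ []) zero

-- The blocks are prescribed only up to `≈`, since those of `C x` are known only in this sense.
∙-snoc : ∀ {m} (x v : Vector ℝ (m ℕ.+ 1)) {y w : Vector ℝ m} {t s : ℝ} →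
         (∀ i → x (i ↑ˡ 1) ≈ y i) → x (m ↑ʳ zero) ≈ t →
         (∀ i → v (i ↑ˡ 1) ≈ w i) → v (m ↑ʳ zero) ≈ s →
         x ∙ v ≈ y ∙ w + t * s
∙-snoc x v x≈y x≈t v≈w v≈s = R.trans (sum-snoc (zipWith _*_ x v))
  (R.+-cong (Sum.sum-cong-≋ λ i → R.*-cong (x≈y i) (v≈w i)) (R.*-cong x≈t v≈s))

∙-⨾ : ∀ {m} (u y : Vector ℝ m) r t → [ u ⨾ r ] ∙ [ y ⨾ t ] ≈ u ∙ y + r * t
∙-⨾ u y r t = ∙-snoc [ u ⨾ r ] [ y ⨾ t ]
  (R.reflexive ∘ ⨾-init u r) (R.reflexive (⨾-last u r))
  (R.reflexive ∘ ⨾-init y t) (R.reflexive (⨾-last y t))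

-- Homogeneous slack and the payoffs of the game

module _ {m} (M : Matrix m m) (q : Vector ℝ m) where

  -- The map z ↦ q + M z, made homogeneous in (z , t).
  slack : Vector ℝ m → ℝ → Vector ℝ m
  slack y t i = M i ∙ y + q i * t

  -- Homogeneity of degree one, which carries the complementarity conditions along the ray through
  -- `(y , t)`.
  slack-*ᵛ : ∀ y t s i → slack (y *ᵛ s) (t * s) i ≈ slack y t i * s
  slack-*ᵛ y t s i = R.trans (R.+-congʳ (∙-*ᵛ (M i) y s))
    (S.solve 4 (λ a b c d → a S.:* d S.:+ b S.:* (c S.:* d) S.:= (a S.:+ b S.:* c) S.:* d) R.refl
      (M i ∙ y) (q i) t s)

  -- Requiring only `t ≈ 1ℝ` admits a product of a real with its reciprocal.
  slack-1 : ∀ z {t} → t ≈ 1ℝ → ∀ i → slack z t i ≈ (q +ᵛ M *ᵐ z) i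
  slack-1 z t≈1 i = R.trans (R.+-comm (M i ∙ z) _)
    (R.+-congʳ (R.trans (R.*-congˡ t≈1) (R.*-identityʳ (q i))))

  module _ (y : Vector ℝ m) (t : ℝ) where

    private
      w : Vector ℝ m
      w = slack y t
      x Cx : Vector ℝ (m ℕ.+ 1)
      x = [ y ⨾ t ]
      Cx = C[ q , M ] *ᵐ x

    -- The summand `t` comes from the `e` in the last column `q + e`.
    Cx-init : ∀ i → Cx (i ↑ˡ 1) ≈ w i + t
    Cx-init i = begin-equality
      Cx (i ↑ˡ 1)
        ≡⟨ ≡.cong (_∙ x) (lookup-++ˡ (zipWith (λ row b → row ++ (b ∷ [])) M (q +ᵛ e)) _ i) ⟩
      [ M i ⨾ q i + 1ℝ ] ∙ x
        ≈⟨ ∙-⨾ (M i) y (q i + 1ℝ) t ⟩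
      M i ∙ y + (q i + 1ℝ) * t
        ≈⟨ S.solve 3 (λ a b c → a S.:+ (b S.:+ S.con 1) S.:* c S.:= (a S.:+ b S.:* c) S.:+ c)
             R.refl (M i ∙ y) (q i) t ⟩
      w i + t ∎
      where open ≤-Reasoning

    Cx-last : Cx (m ↑ʳ zero) ≈ t
    Cx-last = begin-equality
      Cx (m ↑ʳ zero)
        ≡⟨ ≡.cong (_∙ x) (lookup-++ʳ (zipWith (λ row b → row ++ (b ∷ [])) M (q +ᵛ e)) _ zero) ⟩
      [ 0ᵛ ⨾ 1ℝ ] ∙ x     ≈⟨ ∙-⨾ 0ᵛ y 1ℝ t ⟩
      0ᵛ ∙ y + 1ℝ * t     ≈⟨ R.+-cong (0ᵛ-∙ y) (R.*-identityˡ t) ⟩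
      0ℝ + t              ≈⟨ R.+-identityˡ t ⟩
      t                   ∎
      where open ≤-Reasoning

    e∙x≈e∙y+t : e ∙ x ≈ e ∙ y + t
    e∙x≈e∙y+t = R.trans
      (∙-snoc e x {w = y} {s = t} (λ _ → R.refl) R.refl
        (R.reflexive ∘ ⨾-init y t) (R.reflexive (⨾-last y t)))
      (R.+-congˡ (R.*-identityˡ t))

    -- The terms other than `y ∙ w` collect to `(e ∙ y + t) * t`, which the normalisation turns into
    -- `t`.
    x∙Cx : e ∙ y + t ≈ 1ℝ → x ∙ Cx ≈ y ∙ w + t
    x∙Cx e∙y+t≈1 = begin-equality
      x ∙ Cx
        ≈⟨ ∙-snoc x Cx (R.reflexive ∘ ⨾-init y t) (R.reflexive (⨾-last y t)) Cx-init Cx-last ⟩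
      y ∙ (w +ᵛ replicate m t) + t * t
        ≈⟨ R.+-congʳ (R.trans (∙-distribˡ-+ y w (replicate m t)) (R.+-congˡ (∙-replicate y t))) ⟩
      y ∙ w + (e ∙ y) * t + t * t
        ≈⟨ S.solve 3 (λ a b c → (a S.:+ b S.:* c) S.:+ c S.:* c S.:= a S.:+ (b S.:+ c) S.:* c)
             R.refl (y ∙ w) (e ∙ y) t ⟩
      y ∙ w + (e ∙ y + t) * t
        ≈⟨ R.+-congˡ (R.trans (R.*-congʳ e∙y+t≈1) (R.*-identityˡ t)) ⟩
      y ∙ w + t
        ∎
      where open ≤-Reasoning

    -- With `c = y ∙ w`, every entry of `C x` is at least `c + t`. Cancelling `t` gives `c ≤ w i`
    -- from the first rows and `c ≤ 0` from the last; averaging supplies `0 ≤ c`.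
    SNE⇒ : x ∈ SNE C[ q , M ] → 0ℝ < t → (w ≥ᵛ 0ᵛ) × (y ∙ w ≈ 0ℝ) × (y ≥ᵛ 0ᵛ)
    SNE⇒ (Cx≥ , x≥0 , e∙x≈1) 0<t =
      (λ i → ≤-trans 0≤c (init i)) , ≤-antisym last 0≤c , y≥0
      where
      open ≤-Reasoning
      e∙y+t≈1 : e ∙ y + t ≈ 1ℝ
      e∙y+t≈1 = R.trans (R.sym e∙x≈e∙y+t) e∙x≈1

      payoff≤ : ∀ j → y ∙ w + t ≤ Cx j
      -- The factor `1ℝ` is the entry of `e` in `e *ᵛ (x ∙ Cx)`.
      payoff≤ j = begin
        y ∙ w + t         ≈⟨ x∙Cx e∙y+t≈1 ⟨
        x ∙ Cx            ≈⟨ R.*-identityˡ (x ∙ Cx) ⟨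
        1ℝ * (x ∙ Cx)     ≤⟨ Cx≥ j ⟩
        Cx j              ∎

      init : ∀ i → y ∙ w ≤ w i
      init i = +-cancelʳ-≤ t (≤-trans (payoff≤ (i ↑ˡ 1)) (≤-reflexive (Cx-init i)))

      last : y ∙ w ≤ 0ℝ
      last = +-cancelʳ-≤ t (≤-trans (payoff≤ (m ↑ʳ zero))
        (≤-reflexive (R.trans Cx-last (R.sym (R.+-identityˡ t)))))

      y≥0 : y ≥ᵛ 0ᵛ
      y≥0 i = ≤-trans (x≥0 (i ↑ˡ 1)) (≤-reflexive (R.reflexive (⨾-init y t i)))

      0≤c : 0ℝ ≤ y ∙ w
      0≤c = nonneg-of-weighted-min y w t 0<t y≥0 e∙y+t≈1 init

    -- Since `y ∙ w` vanishes, the payoff is exactly `t`. The last row attains it, and row `i`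
    -- exceeds it by `w i ≥ 0`.
    ⇒SNE : w ≥ᵛ 0ᵛ → y ∙ w ≈ 0ℝ → y ≥ᵛ 0ᵛ → 0ℝ ≤ t → e ∙ y + t ≈ 1ℝ → x ∈ SNE C[ q , M ]
    ⇒SNE w≥0 y∙w≈0 y≥0 0≤t e∙y+t≈1 =
      snoc-elim (λ j → 1ℝ * (x ∙ Cx) ≤ Cx j) init last ,
      snoc-elim (λ j → 0ℝ ≤ x j)
        (λ i → ≤-trans (y≥0 i) (≤-reflexive (R.reflexive (≡.sym (⨾-init y t i)))))
        (≤-trans 0≤t (≤-reflexive (R.reflexive (≡.sym (⨾-last y t))))) ,
      R.trans e∙x≈e∙y+t e∙y+t≈1
      where
      open ≤-Reasoning
      payoff≈t : 1ℝ * (x ∙ Cx) ≈ t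
      payoff≈t = begin-equality
        1ℝ * (x ∙ Cx)     ≈⟨ R.*-identityˡ (x ∙ Cx) ⟩
        x ∙ Cx            ≈⟨ x∙Cx e∙y+t≈1 ⟩
        y ∙ w + t         ≈⟨ R.+-congʳ y∙w≈0 ⟩
        0ℝ + t            ≈⟨ R.+-identityˡ t ⟩
        t                 ∎

      init : ∀ i → 1ℝ * (x ∙ Cx) ≤ Cx (i ↑ˡ 1)
      init i = begin
        1ℝ * (x ∙ Cx)     ≈⟨ payoff≈t ⟩
        t                 ≈⟨ R.+-identityˡ t ⟨
        0ℝ + t            ≤⟨ +-mono-≤ (w≥0 i) (≤-reflexive R.refl) ⟩
        w i + t           ≈⟨ Cx-init i ⟨
        Cx (i ↑ˡ 1)       ∎

      last : 1ℝ * (x ∙ Cx) ≤ Cx (m ↑ʳ zero)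
      last = ≤-reflexive (R.trans payoff≈t (R.sym Cx-last))

  -- Rescaling between `t = 1` and total mass 1

  slack⇒SOL : ∀ y t (0<t : 0ℝ < t) → slack y t ≥ᵛ 0ᵛ → y ∙ slack y t ≈ 0ℝ → y ≥ᵛ 0ᵛ →
              y *ᵛ 1/ t 0<t ∈ SOL q M
  slack⇒SOL y t 0<t w≥0 y∙w≈0 y≥0 = w′≥0 , (λ i → *-nonneg (y≥0 i) 0≤s) , z∙w′≈0
    where
    open ≤-Reasoning
    s : ℝ
    s = 1/ t 0<t
    w w′ : Vector ℝ m
    w = slack y t
    w′ = q +ᵛ M *ᵐ (y *ᵛ s)
    0≤s : 0ℝ ≤ s
    0≤s = <⇒≤ (1/-pos t 0<t)

    w′≈ws : ∀ i → w′ i ≈ w i * s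
    -- The slack of `(y *ᵛ s , t * s)` is read in two ways: `t * s ≈ 1ℝ` gives `w′`, and homogeneity
    -- gives `w i * s`.
    w′≈ws i = R.trans (R.sym (slack-1 (y *ᵛ s) (*-1/-inverse t 0<t) i)) (slack-*ᵛ y t s i)

    w′≥0 : w′ ≥ᵛ 0ᵛ
    w′≥0 i = begin
      0ℝ        ≤⟨ *-nonneg (w≥0 i) 0≤s ⟩
      w i * s   ≈⟨ w′≈ws i ⟨
      w′ i      ∎

    z∙w′≈0 : (y *ᵛ s) ∙ w′ ≈ 0ℝ
    z∙w′≈0 = begin-equality
      -- Both the vector and its slack scale by `s`, so the vanishing product acquires `s` twice.
      (y *ᵛ s) ∙ w′         ≈⟨ ∙-congʳ (y *ᵛ s) w′≈ws ⟩
      (y *ᵛ s) ∙ (w *ᵛ s)   ≈⟨ ∙-*ᵛ (y *ᵛ s) w s ⟩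
      ((y *ᵛ s) ∙ w) * s    ≈⟨ R.*-congʳ (*ᵛ-∙ y w s) ⟩
      (y ∙ w) * s * s       ≈⟨ R.*-congʳ (R.*-congʳ y∙w≈0) ⟩
      0ℝ * s * s            ≈⟨ R.trans (R.*-assoc 0ℝ s s) (R.zeroˡ (s * s)) ⟩
      0ℝ                    ∎

  SNE₊⇒SOL : ∀ y t (x∈SNE₊ : (y , t) ∈ SNE₊ C[ q , M ]) → y *ᵛ 1/ t (proj₂ x∈SNE₊) ∈ SOL q M
  SNE₊⇒SOL y t (x∈SNE , 0<t) =
    let w≥0 , y∙w≈0 , y≥0 = SNE⇒ y t x∈SNE 0<t in
    slack⇒SOL y t 0<t w≥0 y∙w≈0 y≥0

  -- The point `(z , 1)` satisfies the homogeneous conditions; scaling it by `t` brings its mass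
  -- `e ∙ z + 1ℝ` to 1. The positivity proof is arbitrary because `1/` takes it as an argument.
  SOL⇒SNE₊ : ∀ z → z ∈ SOL q M → (0<s : 0ℝ < e ∙ z + 1ℝ) →
             let t = 1/ (e ∙ z + 1ℝ) 0<s in (z *ᵛ t , t) ∈ SNE₊ C[ q , M ]
  SOL⇒SNE₊ z (w′≥0 , z≥0 , z∙w′≈0) 0<s =
    ⇒SNE y t w≥0 y∙w≈0′ (λ i → *-nonneg (z≥0 i) 0≤t) 0≤t e∙y+t≈1 , 0<t
    where
    open ≤-Reasoning
    t : ℝ
    t = 1/ (e ∙ z + 1ℝ) 0<s
    y w w′ : Vector ℝ m
    y = z *ᵛ t
    w = slack y t
    w′ = q +ᵛ M *ᵐ z
    0<t : 0ℝ < t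
    0<t = 1/-pos (e ∙ z + 1ℝ) 0<s
    0≤t : 0ℝ ≤ t
    0≤t = <⇒≤ 0<t

    w≈w′t : ∀ i → w i ≈ w′ i * t
    w≈w′t i = begin-equality
      -- Writing `t` as `1ℝ * t` exhibits `(y , t)` as the multiple of `(z , 1)` by `t`.
      M i ∙ y + q i * t           ≈⟨ R.+-congˡ (R.*-congˡ (R.*-identityˡ t)) ⟨
      M i ∙ y + q i * (1ℝ * t)    ≈⟨ slack-*ᵛ z 1ℝ t i ⟩
      slack z 1ℝ i * t            ≈⟨ R.*-congʳ (slack-1 z R.refl i) ⟩
      w′ i * t                    ∎

    w≥0 : w ≥ᵛ 0ᵛ
    w≥0 i = ≤-trans (*-nonneg (w′≥0 i) 0≤t) (≤-reflexive (R.sym (w≈w′t i)))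

    y∙w≈0′ : y ∙ w ≈ 0ℝ
    y∙w≈0′ = begin-equality
      y ∙ w             ≈⟨ ∙-congʳ y w≈w′t ⟩
      y ∙ (w′ *ᵛ t)     ≈⟨ ∙-*ᵛ y w′ t ⟩
      (y ∙ w′) * t      ≈⟨ R.*-congʳ (*ᵛ-∙ z w′ t) ⟩
      (z ∙ w′) * t * t  ≈⟨ R.*-congʳ (R.*-congʳ z∙w′≈0) ⟩
      0ℝ * t * t        ≈⟨ R.trans (R.*-assoc 0ℝ t t) (R.zeroˡ (t * t)) ⟩
      0ℝ                ∎

    e∙y+t≈1 : e ∙ y + t ≈ 1ℝ
    e∙y+t≈1 = begin-equality
      e ∙ y + t             ≈⟨ R.+-cong (∙-*ᵛ e z t) (R.sym (R.*-identityˡ t)) ⟩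
      (e ∙ z) * t + 1ℝ * t  ≈⟨ R.distribʳ t (e ∙ z) 1ℝ ⟨
      (e ∙ z + 1ℝ) * t      ≈⟨ *-1/-inverse (e ∙ z + 1ℝ) 0<s ⟩
      1ℝ                    ∎

theorem2 :
    (m : ℕ) (M : Matrix m m) (q : Vector ℝ m) →
    ( (ȳ : Vector ℝ m) (t̄ : ℝ) (x̄∈SNE₊ : (ȳ , t̄) ∈ SNE₊ C[ q , M ]) →
      let z̄ = ȳ *ᵛ 1/ t̄ (proj₂ x̄∈SNE₊)
      in z̄ ∈ SOL q M )
    ×
    ( (z̄ : Vector ℝ m) (z̄∈SOL : z̄ ∈ SOL q M) →
      let t̄ = 1/ (e ∙ z̄ + 1ℝ) (e∙z+1-pos (proj₁ (proj₂ z̄∈SOL)))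
          ȳ = z̄ *ᵛ t̄
      in (ȳ , t̄) ∈ SNE₊ C[ q , M ] )
theorem2 m M q =
  SNE₊⇒SOL M q ,
  λ z̄ z̄∈SOL → SOL⇒SNE₊ M q z̄ z̄∈SOL (e∙z+1-pos (proj₁ (proj₂ z̄∈SOL)))
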